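{- For every even integer $n\geq4$, $$p(n)\equiv\gamma(4)+\gamma(6)+\gamma(8)+\cdots+\gamma(n-2)+\gamma(n)\pmod2,$$ i.e. $p(n)\equiv\sum_{j=2}^{n/2}\gamma(2j)\pmod 2$.
   Context: $p(n)$ is the number of integer partitions of $n$. A nuclear partition is an integer partition with no part equal to $1$. $\gamma(n)$ denotes the number of nuclear partitions $\mu=(\mu_1,\mu_2,\dots,\mu_r)$ of $n$, with $\mu_1\geq\mu_2\geq\dots\geq\mu_r\geq2$ and $r\geq2$, such that $\mu_1=\mu_2$ (so the two largest parts are equal). -}

module Defs where

open import Data.List.Base
  using (List; []; _∷_; length; filter; upTo; applyUpTo; cartesianProductWith)
open import Data.List.Membership.Propositional using (_∈_; _∉_)
open import Data.List.Membership.Propositional.Properties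
  using (∈-cartesianProductWith⁺; ∈-cartesianProductWith⁻; ∈-filter⁺; ∈-filter⁻; ∈-upTo⁺)
open import Data.List.Properties using (∷-injective)
open import Data.List.Relation.Unary.All as All using (All; []; _∷_)
open import Data.List.Relation.Unary.AllPairs using ([]; _∷_)
open import Data.List.Relation.Unary.Any using (here; there)
open import Data.List.Relation.Unary.Linked as Linked using (Linked)
open import Data.List.Relation.Unary.Unique.Propositional using (Unique)
import Data.List.Relation.Unary.Unique.Propositional.Properties as Unique
open import Data.Nat.Base
  using (ℕ; zero; suc; _+_; _∸_; _≤_; _<_; _≥_; z≤n; s≤s)
open import Data.Nat.ListAction using (sum)
open import Data.Nat.Properties
  using (_≟_; _≥?_; ≤-trans; m≤m+n; m≤n+m; +-mono-≤)
open import Data.Product using (_,_; proj₂)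
open import Function.Bundles using (_⇔_; mk⇔)
open import Relation.Binary.PropositionalEquality using (_≡_; _≢_; refl)
open import Relation.Nullary.Decidable using (Dec; no; map′; ¬?; _×-dec_)

record IsPartition (n : ℕ) (μ : List ℕ) : Set where
  constructor mkIsPartition
  field
    decreasing : Linked _≥_ μ
    positive   : All (_≥ 1) μ
    sums       : sum μ ≡ n

isPartition? : ∀ n μ → Dec (IsPartition n μ)
isPartition? n μ =
  map′ (λ (d , p , s) → mkIsPartition d p s)
       (λ (mkIsPartition d p s) → d , p , s)
       (Linked.linked? _≥?_ μ ×-dec All.all? (_≥? 1) μ ×-dec (sum μ ≟ n))

IsNuclear : List ℕ → Set
IsNuclear = All (_≢ 1)

isNuclear? : ∀ μ → Dec (IsNuclear μ)
isNuclear? = All.all? (λ k → ¬? (k ≟ 1))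

-- For a partition, whose parts are listed in weakly decreasing order, the two
-- largest parts are the first two entries; in particular there must be at
-- least two parts.
data LargestTwoEqual : List ℕ → Set where
  μ₁≡μ₂ : ∀ {μ₁ μ₂ μs} → μ₁ ≡ μ₂ → LargestTwoEqual (μ₁ ∷ μ₂ ∷ μs)

largestTwoEqual? : ∀ μ → Dec (LargestTwoEqual μ)
largestTwoEqual? []             = no λ ()
largestTwoEqual? (_ ∷ [])       = no λ ()
largestTwoEqual? (μ₁ ∷ μ₂ ∷ μs) =
  map′ μ₁≡μ₂ (λ { (μ₁≡μ₂ eq) → eq }) (μ₁ ≟ μ₂)

-- All lists of length at most ℓ with entries smaller than b.
words : ℕ → ℕ → List (List ℕ)
words zero    b = [] ∷ []
words (suc ℓ) b = [] ∷ cartesianProductWith _∷_ (upTo b) (words ℓ b)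

-- A partition of n has at most n parts, each at most n, so no partition is
-- missed; see ∈-partitions and partitions-unique below.
partitions : ℕ → List (List ℕ)
partitions n = filter (isPartition? n) (words n (suc n))

p : ℕ → ℕ
p n = length (partitions n)

γ : ℕ → ℕ
γ n = length
  (filter (λ μ → isNuclear? μ ×-dec largestTwoEqual? μ) (partitions n))

-- f a + f (a + 1) + ⋯ + f b, which is 0 when b < a.
sumFromTo : ℕ → ℕ → (ℕ → ℕ) → ℕ
sumFromTo a b f = sum (applyUpTo (λ i → f (a + i)) (suc b ∸ a))

words-unique : ∀ ℓ b → Unique (words ℓ b)
words-unique zero    b = [] ∷ []
words-unique (suc ℓ) b =
  All.tabulate (λ { w∈ refl → []∉ w∈ }) ∷
  Unique.cartesianProductWith⁺ _∷_ ∷-injective (Unique.upTo⁺ b) (words-unique ℓ b)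
  where
  []∉ : [] ∉ cartesianProductWith _∷_ (upTo b) (words ℓ b)
  []∉ w∈ with ∈-cartesianProductWith⁻ _∷_ (upTo b) (words ℓ b) w∈
  ... | _ , _ , _ , _ , ()

∈-words : ∀ ℓ b {μ} → length μ ≤ ℓ → All (_< b) μ → μ ∈ words ℓ b
∈-words zero    b {[]}    _         _          = here refl
∈-words (suc ℓ) b {[]}    _         _          = here refl
∈-words (suc ℓ) b {_ ∷ _} (s≤s len) (k<b ∷ bd) =
  there (∈-cartesianProductWith⁺ _∷_ (∈-upTo⁺ k<b) (∈-words ℓ b len bd))

length≤sum : ∀ {μ} → All (_≥ 1) μ → length μ ≤ sum μ
length≤sum []          = z≤n
length≤sum (k≥1 ∷ pos) = +-mono-≤ k≥1 (length≤sum pos)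

parts≤sum : ∀ μ → All (_≤ sum μ) μ
parts≤sum []      = []
parts≤sum (k ∷ μ) =
  m≤m+n k (sum μ) ∷ All.map (λ j≤ → ≤-trans j≤ (m≤n+m (sum μ) k)) (parts≤sum μ)

∈-partitions : ∀ {n μ} → μ ∈ partitions n ⇔ IsPartition n μ
∈-partitions {n} {μ} = mk⇔
  (λ μ∈ → proj₂ (∈-filter⁻ (isPartition? n) {xs = words n (suc n)} μ∈))
  (λ isP → ∈-filter⁺ (isPartition? n) (complete isP) isP)
  where
  complete : ∀ {n μ} → IsPartition n μ → μ ∈ words n (suc n)
  complete {μ = μ} (mkIsPartition _ pos refl) =
    ∈-words _ _ (length≤sum pos) (All.map s≤s (parts≤sum μ))

partitions-unique : ∀ n → Unique (partitions n)
partitions-unique n = Unique.filter⁺ (isPartition? n) (words-unique n (suc n))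

{-# OPTIONS --safe #-}
module Submission where

-- Let ν n be the number of nuclear partitions of n. Removing one part 1 gives
-- p (n + 1) = p n + ν (n + 1), and increasing the largest part by 1 gives
-- ν (n + 1) = ν n + γ (n + 1) for n ≥ 2. Together,
-- p (n + 2) = p n + γ (n + 2) + 2 ν (n + 1) for n ≥ 1.

open import Data.List.Base
  using (List; []; _∷_; [_]; _∷ʳ_; length; filter; map; applyUpTo)
open import Data.List.Membership.Propositional using (_∈_)
open import Data.List.Membership.Propositional.Properties
  using (∈-filter⁺; ∈-filter⁻; ∈-map⁺; ∈-map⁻)
open import Data.List.Properties using (∷ʳ-injectiveˡ; length-map; applyUpTo-∷ʳ)
open import Data.List.Relation.Binary.Permutation.Propositional using (_↭_)
open import Data.List.Relation.Binary.Permutation.Propositional.Properties using (↭-length)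
open import Data.List.Relation.Binary.BagAndSetEquality using (∼bag⇒↭)
open import Data.List.Membership.Propositional.Properties.WithK using (unique∧set⇒bag)
open import Data.List.Relation.Unary.All using (All; []; _∷_)
import Data.List.Relation.Unary.All.Properties as All
open import Data.List.Relation.Unary.Any using (here; there)
open import Data.List.Relation.Unary.Linked using (Linked; []; [-]; _∷_)
open import Data.List.Relation.Unary.Unique.Propositional using (Unique)
import Data.List.Relation.Unary.Unique.Propositional.Properties as Unique
open import Data.Bool.Base using (true; false)
open import Data.Nat.Base
  using (ℕ; zero; suc; _+_; _≤_; _≥_; _*_; z≤n; s≤s; s≤s⁻¹)
open import Data.Nat.DivMod using (_/_; _%_; m*n/n≡m; [m+kn]%n≡m%n; %-distribˡ-+)
open import Data.Nat.Divisibility using (_∣_; divides)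
open import Data.Nat.ListAction using (sum)
open import Data.Nat.ListAction.Properties using (sum-++)
open import Data.Nat.Properties
  using (_≟_; ≤-refl; ≤-trans; ≤-antisym; <-irrefl; ≤∧≢⇒<; m≤n⇒m≤1+n; suc-injective; +-comm; +-suc;
         +-identityʳ; *-comm; *-suc)
open import Data.Nat.Tactic.RingSolver using (solve-∀)
open import Data.Product using (∃; _×_; _,_; proj₁; proj₂)
open import Function.Base using (_∘_)
open import Function.Bundles using (mk⇔; Equivalence)
open import Function.Definitions using (Injective)
open import Level using (Level)
open import Relation.Binary.PropositionalEquality
  using (_≡_; refl; sym; trans; cong; cong₂; subst; module ≡-Reasoning)
open import Relation.Nullary using (¬_; does; yes; no; contradiction)
open import Relation.Nullary.Decidable using (_×-dec_)
open import Relation.Unary using (Pred; Decidable)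
open import Relation.Unary.Properties using (∁?)
open import Defs

private
  variable
    a b ℓ₁ ℓ₂ : Level
    A : Set a
    B : Set b

-- Counting list entries by complementary filters and by bijections.

module _ {P : Pred A ℓ₁} (P? : Decidable P) where

  length-filter-∁ : ∀ xs → length xs ≡ length (filter P? xs) + length (filter (∁? P?) xs)
  length-filter-∁ []       = refl
  length-filter-∁ (x ∷ xs) with does (P? x)
  ... | true  = cong suc (length-filter-∁ xs)
  ... | false = trans (cong suc (length-filter-∁ xs)) (sym (+-suc _ _))

  -- `γ` filters by a conjunction. The nested form presents its lists as a sublist of the nuclear
  -- partitions, which `length-filter-∁` can then split.
  filter-×-dec : ∀ {Q : Pred A ℓ₂} (Q? : Decidable Q) xs →
                 filter (λ x → P? x ×-dec Q? x) xs ≡ filter Q? (filter P? xs)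
  filter-×-dec Q? []       = refl
  filter-×-dec Q? (x ∷ xs) with does (P? x)
  ... | false = filter-×-dec Q? xs
  ... | true with does (Q? x)
  ...   | true  = cong (x ∷_) (filter-×-dec Q? xs)
  ...   | false = filter-×-dec Q? xs

-- Injectivity keeps `map f xs` free of duplicates. Two duplicate-free lists with the same members
-- are permutations of each other, hence equally long.
length-bijection : ∀ {xs : List A} {ys : List B} {f : A → B} →
  Unique xs → Unique ys → Injective _≡_ _≡_ f →
  (∀ {x} → x ∈ xs → f x ∈ ys) →
  (∀ {y} → y ∈ ys → ∃ λ x → x ∈ xs × y ≡ f x) →
  length ys ≡ length xs
length-bijection {xs = xs} {ys} {f} xs! ys! f-inj to from =
  trans (sym (↭-length map↭)) (length-map f xs)
  where
  map↭ : map f xs ↭ ys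
  map↭ = ∼bag⇒↭ (unique∧set⇒bag (Unique.map⁺ f-inj xs!) ys! (mk⇔
    (λ y∈ → let _ , x∈ , eq = ∈-map⁻ f y∈ in subst (_∈ ys) (sym eq) (to x∈))
    (λ y∈ → let _ , x∈ , eq = from y∈ in subst (_∈ map f xs) (sym eq) (∈-map⁺ f x∈))))

isPartition : ∀ n {μ} → μ ∈ partitions n → IsPartition n μ
isPartition _ = Equivalence.to ∈-partitions

∈-partitions⁺ : ∀ n {μ} → IsPartition n μ → μ ∈ partitions n
∈-partitions⁺ _ = Equivalence.from ∈-partitions

-- Non-nuclear partitions: appending and removing a part 1.

sum-∷ʳ1 : ∀ μ → sum (μ ∷ʳ 1) ≡ suc (sum μ)
sum-∷ʳ1 μ = trans (sum-++ μ [ 1 ]) (+-comm (sum μ) 1)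

Linked-∷ʳ1⁺ : ∀ {μ} → Linked _≥_ μ → All (_≥ 1) μ → Linked _≥_ (μ ∷ʳ 1)
Linked-∷ʳ1⁺ []        []        = [-]
Linked-∷ʳ1⁺ [-]       (k≥1 ∷ _) = k≥1 ∷ [-]
Linked-∷ʳ1⁺ (k≥j ∷ d) (_ ∷ pos) = k≥j ∷ Linked-∷ʳ1⁺ d pos

Linked-∷ʳ⁻ : ∀ {R : A → A → Set ℓ₁} xs {x} → Linked R (xs ∷ʳ x) → Linked R xs
Linked-∷ʳ⁻ []           _         = []
Linked-∷ʳ⁻ (_ ∷ [])     _         = [-]
Linked-∷ʳ⁻ (_ ∷ _ ∷ xs) (r ∷ rxs) = r ∷ Linked-∷ʳ⁻ (_ ∷ xs) rxs

isPartition-∷ʳ1⁺ : ∀ {n μ} → IsPartition n μ → IsPartition (suc n) (μ ∷ʳ 1)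
isPartition-∷ʳ1⁺ {μ = μ} (mkIsPartition d pos s) =
  mkIsPartition (Linked-∷ʳ1⁺ d pos) (All.∷ʳ⁺ pos ≤-refl) (trans (sum-∷ʳ1 μ) (cong suc s))

isPartition-∷ʳ1⁻ : ∀ {n μ} → IsPartition (suc n) (μ ∷ʳ 1) → IsPartition n μ
isPartition-∷ʳ1⁻ {μ = μ} (mkIsPartition d pos s) =
  mkIsPartition (Linked-∷ʳ⁻ μ d) (proj₁ (All.∷ʳ⁻ pos))
                (suc-injective (trans (sym (sum-∷ʳ1 μ)) s))

¬isNuclear-∷ʳ1 : ∀ {μ} → ¬ IsNuclear (μ ∷ʳ 1)
¬isNuclear-∷ʳ1 nuc = proj₂ (All.∷ʳ⁻ nuc) refl

-- Once a part equals 1, every later part is squeezed between 1 and 1, so the last part is 1 as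
-- well.
1∈⇒∷ʳ1 : ∀ {μ} → Linked _≥_ μ → All (_≥ 1) μ → 1 ∈ μ → ∃ λ ν → μ ≡ ν ∷ʳ 1
1∈⇒∷ʳ1 [-] _ (here refl) = [] , refl
1∈⇒∷ʳ1 {k ∷ _} (k≥j ∷ d) (_ ∷ j≥1 ∷ pos) 1∈ =
  let ν , eq = 1∈⇒∷ʳ1 d (j≥1 ∷ pos) (tail∋1 1∈) in k ∷ ν , cong (k ∷_) eq
  where
  tail∋1 : 1 ∈ k ∷ _ → 1 ∈ _
  tail∋1 (here refl) = here (≤-antisym j≥1 k≥j)
  tail∋1 (there 1∈)  = 1∈

¬nuclear⇒1∈ : ∀ {μ} → ¬ IsNuclear μ → 1 ∈ μ
¬nuclear⇒1∈ {[]}    ¬nuc = contradiction [] ¬nuc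
¬nuclear⇒1∈ {k ∷ μ} ¬nuc with k ≟ 1
... | yes k≡1 = here (sym k≡1)
... | no  k≢1 = there (¬nuclear⇒1∈ (¬nuc ∘ (k≢1 ∷_)))

ν : ℕ → ℕ
ν n = length (filter isNuclear? (partitions n))

-- The non-nuclear partitions of `suc n` are exactly the lists `μ ∷ʳ 1` with `μ` a partition of `n`;
-- the others are counted by `ν`.
p-suc : ∀ n → p (suc n) ≡ ν (suc n) + p n
p-suc n = trans (length-filter-∁ isNuclear? (partitions (suc n)))
  (cong (ν (suc n) +_) (length-bijection
    (partitions-unique n)
    (Unique.filter⁺ (∁? isNuclear?) (partitions-unique (suc n)))
    (λ {μ} {μ′} → ∷ʳ-injectiveˡ μ μ′)
    (λ μ∈ → ∈-filter⁺ (∁? isNuclear?)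
      (∈-partitions⁺ (suc n) (isPartition-∷ʳ1⁺ (isPartition n μ∈))) ¬isNuclear-∷ʳ1)
    from))
  where
  from : ∀ {μ} → μ ∈ filter (∁? isNuclear?) (partitions (suc n)) →
         ∃ λ μ′ → μ′ ∈ partitions n × μ ≡ μ′ ∷ʳ 1
  from μ∈ with ∈-filter⁻ (∁? isNuclear?) {xs = partitions (suc n)} μ∈
  ... | μ∈ps , ¬nuc with isPartition (suc n) μ∈ps
  ...   | isP with 1∈⇒∷ʳ1 (IsPartition.decreasing isP) (IsPartition.positive isP)
                          (¬nuclear⇒1∈ ¬nuc)
  ...     | μ′ , refl = μ′ , ∈-partitions⁺ n (isPartition-∷ʳ1⁻ isP) , refl

-- Nuclear partitions: increasing the largest part.

growLargest : List ℕ → List ℕ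
-- A default value: the partitions concerned have positive sum, so `[]` never occurs among them.
-- Fixing `[]` keeps the map injective on all lists, as `length-bijection` requires.
growLargest []      = []
growLargest (k ∷ μ) = suc k ∷ μ

growLargest-injective : Injective _≡_ _≡_ growLargest
growLargest-injective {[]}    {[]}    _    = refl
growLargest-injective {_ ∷ _} {_ ∷ _} refl = refl

IsNuclearPartition : ℕ → List ℕ → Set
IsNuclearPartition n μ = IsPartition n μ × IsNuclear μ

growLargest⁺ : ∀ {n μ} → IsNuclearPartition (suc n) μ →
  IsNuclearPartition (2 + n) (growLargest μ) × ¬ LargestTwoEqual (growLargest μ)
growLargest⁺ {μ = []} (mkIsPartition _ _ () , _)
-- Matching positivity with `s≤s _` exhibits the old head as a successor. The new head is then a
-- double successor, so it differs from 1 by computation.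
growLargest⁺ {μ = _ ∷ []} (mkIsPartition [-] (s≤s _ ∷ []) s , _ ∷ []) =
  (mkIsPartition [-] (s≤s z≤n ∷ []) (cong suc s) , (λ ()) ∷ []) , λ ()
growLargest⁺ {μ = _ ∷ _ ∷ _} (mkIsPartition (k≥j ∷ d) (s≤s _ ∷ pos) s , _ ∷ nuc) =
  (mkIsPartition (m≤n⇒m≤1+n k≥j ∷ d) (s≤s z≤n ∷ pos) (cong suc s) , (λ ()) ∷ nuc) ,
  λ { (μ₁≡μ₂ refl) → <-irrefl refl k≥j }

-- The sum 3 + n excludes μ = [ 2 ], which would come from the non-nuclear [ 1 ].
growLargest⁻ : ∀ {n μ} → IsNuclearPartition (3 + n) μ → ¬ LargestTwoEqual μ →
  ∃ λ μ′ → IsNuclearPartition (2 + n) μ′ × μ ≡ growLargest μ′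
growLargest⁻ {μ = []} (mkIsPartition _ _ () , _) _
growLargest⁻ {n} {k ∷ []} (mkIsPartition _ _ s , _) _
  -- A single part must be `3 + n` itself, so its preimage is `[ 2 + n ]`, which is nuclear.
  with refl ← trans (sym (+-identityʳ k)) s =
  [ 2 + n ] , (mkIsPartition [-] (s≤s z≤n ∷ []) (+-identityʳ _) , (λ ()) ∷ []) , refl
growLargest⁻ {μ = suc k ∷ j ∷ μ} (mkIsPartition (k≥j ∷ d) (_ ∷ j≥1 ∷ pos) s , _ ∷ j≢1 ∷ nuc) ¬eq =
  k ∷ j ∷ μ ,
  (mkIsPartition (j≤k ∷ d) (≤-trans j≥1 j≤k ∷ j≥1 ∷ pos) (suc-injective s) ,
   -- The lowered head cannot be 1: the second part `j` would then be at most 1, hence equal to 1.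
   (λ { refl → j≢1 (≤-antisym j≤k j≥1) }) ∷ j≢1 ∷ nuc) , refl
  where
  j≤k : j ≤ k
  j≤k = s≤s⁻¹ (≤∧≢⇒< k≥j (¬eq ∘ μ₁≡μ₂ ∘ sym))

-- Nuclear partitions whose two largest parts agree are counted by `γ`. The remaining ones are the
-- image under `growLargest` of the nuclear partitions of `2 + n`.
ν-suc : ∀ n → ν (3 + n) ≡ γ (3 + n) + ν (2 + n)
ν-suc n = trans (length-filter-∁ largestTwoEqual? nuclears)
  (cong₂ _+_
    (cong length (sym (filter-×-dec isNuclear? largestTwoEqual? (partitions (3 + n)))))
    (length-bijection
      (Unique.filter⁺ isNuclear? (partitions-unique (2 + n)))
      (Unique.filter⁺ (∁? largestTwoEqual?)
        (Unique.filter⁺ isNuclear? (partitions-unique (3 + n))))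
      growLargest-injective to from))
  where
  nuclears : List (List ℕ)
  nuclears = filter isNuclear? (partitions (3 + n))

  to : ∀ {μ} → μ ∈ filter isNuclear? (partitions (2 + n)) →
       growLargest μ ∈ filter (∁? largestTwoEqual?) nuclears
  to μ∈ with ∈-filter⁻ isNuclear? {xs = partitions (2 + n)} μ∈
  ... | μ∈ps , nuc with growLargest⁺ (isPartition (2 + n) μ∈ps , nuc)
  ...   | (isP′ , nuc′) , ¬eq =
    ∈-filter⁺ (∁? largestTwoEqual?)
      (∈-filter⁺ isNuclear? (∈-partitions⁺ (3 + n) isP′) nuc′) ¬eq

  from : ∀ {μ} → μ ∈ filter (∁? largestTwoEqual?) nuclears →
         ∃ λ μ′ → μ′ ∈ filter isNuclear? (partitions (2 + n)) × μ ≡ growLargest μ′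
  from μ∈ with ∈-filter⁻ (∁? largestTwoEqual?) {xs = nuclears} μ∈
  ... | μ∈nuc , ¬eq with ∈-filter⁻ isNuclear? {xs = partitions (3 + n)} μ∈nuc
  ...   | μ∈ps , nuc with growLargest⁻ (isPartition (3 + n) μ∈ps , nuc) ¬eq
  ...     | μ′ , (isP′ , nuc′) , eq =
    μ′ , ∈-filter⁺ isNuclear? (∈-partitions⁺ (2 + n) isP′) nuc′ , eq

-- Parity and summation over even arguments.

p-step : ∀ n → p (3 + n) % 2 ≡ (p (1 + n) + γ (3 + n)) % 2
p-step n = begin
  p (3 + n) % 2
    ≡⟨ cong (_% 2) (p-suc (2 + n)) ⟩
  (ν (3 + n) + p (2 + n)) % 2
    ≡⟨ cong (_% 2) (cong₂ _+_ (ν-suc n) (p-suc (1 + n))) ⟩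
  (γ (3 + n) + ν (2 + n) + (ν (2 + n) + p (1 + n))) % 2
    -- Each of the two recurrences contributes one `ν (2 + n)`; together they form a multiple of 2.
    ≡⟨ cong (_% 2) (regroup (γ (3 + n)) (ν (2 + n)) (p (1 + n))) ⟩
  (p (1 + n) + γ (3 + n) + ν (2 + n) * 2) % 2
    ≡⟨ [m+kn]%n≡m%n (p (1 + n) + γ (3 + n)) (ν (2 + n)) 2 ⟩
  (p (1 + n) + γ (3 + n)) % 2 ∎
  where
  open ≡-Reasoning
  regroup : ∀ g v q → g + v + (v + q) ≡ q + g + v * 2
  regroup = solve-∀

-- `applyUpTo` unfolds at the front, whereas the induction in `p-even` adds its new term at the end.
sum-applyUpTo-suc : ∀ (f : ℕ → ℕ) k → sum (applyUpTo f (suc k)) ≡ sum (applyUpTo f k) + f k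
sum-applyUpTo-suc f k = begin
  sum (applyUpTo f (suc k))       ≡⟨ cong sum (applyUpTo-∷ʳ f k) ⟨
  sum (applyUpTo f k ∷ʳ f k)      ≡⟨ sum-++ (applyUpTo f k) [ f k ] ⟩
  sum (applyUpTo f k) + (f k + 0) ≡⟨ cong (sum (applyUpTo f k) +_) (+-identityʳ (f k)) ⟩
  sum (applyUpTo f k) + f k       ∎
  where open ≡-Reasoning

p-even : ∀ k → p (2 * suc k) % 2 ≡ sum (applyUpTo (λ i → γ (2 * (2 + i))) k) % 2
-- The induction starts at `p 2`, which evaluates to 2, against the empty sum.
p-even zero    = refl
p-even (suc k) = begin
  p (2 * (2 + k)) % 2             ≡⟨ cong (λ m → p m % 2) 2*[2+k]≡ ⟩
  p (3 + m) % 2                   ≡⟨ p-step m ⟩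
  (p (1 + m) + γ (3 + m)) % 2     ≡⟨ cong (λ m′ → (p (1 + m) + γ m′) % 2) 2*[2+k]≡ ⟨
  (p (2 * suc k) + f k) % 2       ≡⟨ %-distribˡ-+ (p (2 * suc k)) (f k) 2 ⟩
  (p (2 * suc k) % 2 + f k % 2) % 2 ≡⟨ cong (λ r → (r + f k % 2) % 2) (p-even k) ⟩
  (S % 2 + f k % 2) % 2           ≡⟨ %-distribˡ-+ S (f k) 2 ⟨
  (S + f k) % 2                   ≡⟨ cong (_% 2) (sum-applyUpTo-suc f k) ⟨
  sum (applyUpTo f (suc k)) % 2   ∎
  where
  open ≡-Reasoning
  f : ℕ → ℕ
  f i = γ (2 * (2 + i))
  m S : ℕ
  -- Chosen so that `2 * suc k` is `1 + m` by computation, which lets `p-step m` meet the induction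
  -- hypothesis.
  m = k + 1 * suc k
  S = sum (applyUpTo f k)
  2*[2+k]≡ : 2 * (2 + k) ≡ 3 + m
  2*[2+k]≡ = *-suc 2 (suc k)

mainTheorem10 : (n : ℕ) → 2 ∣ n → n ≥ 4 →
    p n % 2 ≡ sumFromTo 2 (n / 2) (λ j → γ (2 * j)) % 2
mainTheorem10 _ (divides zero refl) ()
mainTheorem10 _ (divides (suc k) refl) _ = begin
  p (suc k * 2) % 2                 ≡⟨ cong (λ m → p m % 2) (*-comm (suc k) 2) ⟩
  -- The number of terms, `suc (suc k) ∸ 2`, computes to `k`, so `sumFromTo 2 (suc k) f` is by
  -- definition the sum in `p-even k`.
  p (2 * suc k) % 2                 ≡⟨ p-even k ⟩
  sumFromTo 2 (suc k) f % 2         ≡⟨ cong (λ h → sumFromTo 2 h f % 2) (m*n/n≡m (suc k) 2) ⟨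
  sumFromTo 2 (suc k * 2 / 2) f % 2 ∎
  where
  open ≡-Reasoning
  f : ℕ → ℕ
  f j = γ (2 * j)
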